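{- Let $X$ be a finite nonempty set of cardinality $n$ and let $N=\binom{n}{2}$. The number of regular elements in $\mathcal{M}(X)$ is exactly $$\sum_{d=1}^n\binom{n}{d}\left(n^2-n+d\right)^{N}\mathrm{Surj}(n,d).$$
   Context: $\mathcal{M}(X)=X^{X\times X}$ is the set of all binary operations on $X$, a monoid under $\triangleright$ defined by $a(\circ\triangleright\ast)b=(a\circ b)\ast(b\circ a)$ for all $a,b\in X$. An element $\ast\in\mathcal{M}(X)$ is regular if there is $\circ\in\mathcal{M}(X)$ with $\ast\triangleright\circ\triangleright\ast=\ast$. $\mathrm{Surj}(m,k)$ denotes the number of surjective maps from an $m$-element set onto a $k$-element set. -}

module Defs where

open import Algebra.Bundles using (Monoid)
open import Algebra.Core using (Op₂)
open import Data.Fin.Base using (Fin; finToFun)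
open import Data.Fin.Properties using (_≟_; all?; any?)
open import Data.List.Base using (applyUpTo)
open import Data.Nat.Base using (ℕ; suc; _^_)
open import Data.Nat.ListAction using (sum)
open import Data.Product.Base using (_,_; ∃; proj₁)
open import Data.Vec.Base using (allFin; count)
open import Function.Bundles using (Inverse)
open import Function.Definitions using (StrictlySurjective)
open import Level using (Level; _⊔_)
open import Relation.Binary.Bundles using (Setoid)
import Relation.Binary.Construct.On as On
open import Relation.Binary.PropositionalEquality
  using (_≡_; refl; sym; trans; cong₂; setoid)
open import Relation.Nullary.Decidable.Core using (Dec)

private
  variable
    a ℓ : Level

HasCardinality : Setoid a ℓ → ℕ → Set (a ⊔ ℓ)
HasCardinality S k = Inverse S (setoid (Fin k))

infixl 7 _▷_
_▷_ : {X : Set a} → Op₂ (Op₂ X)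
(_∘_ ▷ _*_) a b = (a ∘ b) * (b ∘ a)

-- Operations are compared pointwise, since function extensionality is not
-- available.
𝓜 : Set a → Monoid a a
𝓜 X = record
  { Carrier  = Op₂ X
  ; _≈_      = λ _∘_ _*_ → ∀ a b → a ∘ b ≡ a * b
  ; _∙_      = _▷_
  ; ε        = λ a b → a
  ; isMonoid = record
    { isSemigroup = record
      { isMagma = record
        { isEquivalence = record
          { refl  = λ a b → refl
          ; sym   = λ p a b → sym (p a b)
          ; trans = λ p q a b → trans (p a b) (q a b)
          }
        ; ∙-cong = λ {_} {_∘′_} {_*_} p q a b →
            trans (cong₂ _*_ (p a b) (p b a)) (q (a ∘′ b) (b ∘′ a))
        }
      ; assoc = λ _ _ _ a b → refl
      }
    ; identity = (λ _ a b → refl) , (λ _ a b → refl)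
    }
  }

module _ (M : Monoid a ℓ) where
  open Monoid M renaming (setoid to M-setoid)

  Regular : Carrier → Set (a ⊔ ℓ)
  Regular x = ∃ λ y → x ∙ y ∙ x ≈ x

  -- Equality ignores the regularity witness, so that each regular element
  -- is counted once.
  regularElements : Setoid (a ⊔ ℓ) ℓ
  regularElements = On.setoid {B = ∃ Regular} M-setoid proj₁

surjective? : ∀ {m k} (f : Fin m → Fin k) → Dec (StrictlySurjective _≡_ f)
surjective? f = all? λ y → any? λ x → f x ≟ y

-- finToFun enumerates the maps Fin m → Fin k, each exactly once, by Fin (k ^ m).
Surj : ℕ → ℕ → ℕ
Surj m k = count (λ i → surjective? (finToFun {k} {m} i)) (allFin (k ^ m))

-- ∑₁ n f = f 1 + ⋯ + f n
∑₁ : ℕ → (ℕ → ℕ) → ℕ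
∑₁ n f = sum (applyUpTo (λ i → f (suc i)) n)

syntax ∑₁ n (λ d → e) = ∑[1≤ d ≤ n ] e

{-# OPTIONS --safe #-}
-- The regular operations are those _*_ for which every value x * y = y * x is also
-- a value z * z.  Necessity: with a pseudo-inverse _⊙_, z = u ⊙ u for u = x * y.
-- So a regular operation is a diagonal map f together with, for each of the N
-- unordered pairs {x , y}, a value (x * y , y * x) that is off the diagonal or
-- lies over the image of f: (n² − n + |im f|)^N choices for each f.
-- The number I m n d of maps from m to n points with image of size d satisfies
-- I (m+1) n (d+1) = (d+1) I m n (d+1) + (n−d) I m n d; by the absorption identity
-- (n−d) C(n,d) = (d+1) C(n,d+1) so does C(n,d) · I m d d, and I m d d = Surj m d.
module Submission where

open import Defs
open import Algebra.Bundles using (Monoid)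
open import Algebra.Core using (Op₂)
open import Data.Bool.Base using (if_then_else_; true; false)
open import Data.Fin.Base as Fin
  using (Fin; zero; suc; toℕ; fromℕ<; splitAt; _↑ˡ_; _↑ʳ_; combine; remQuot; finToFun; funToFin)
open import Data.Fin.Properties as Fin using (_≟_; all?; any?)
open import Data.List.Base using (applyUpTo)
open import Data.Nat.Base
  using (ℕ; zero; suc; NonZero; _+_; _*_; _∸_; _^_; _≤_; z≤n; s≤s)
open import Data.Nat.Combinatorics using (_C_; nC1≡n; nCn≡1; k>n⇒nCk≡0; nCk+nC[k+1]≡[n+1]C[k+1])
import Data.Nat.ListAction as List
open import Data.Nat.Properties as ℕ
  using ( +-assoc; +-identityʳ; *-assoc; *-comm; *-identityˡ; *-identityʳ; *-zeroʳ
        ; *-distribˡ-∸; *-distribʳ-∸; m+n∸m≡n; m+n∸n≡m; m≤n⇒m≤1+n; 1+n≰n; suc-injective)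
open import Data.Nat.Solver using (module +-*-Solver)
open import Data.Product.Base using (∃; ∃₂; _×_; _,_; proj₁; proj₂; uncurry)
open import Data.Sum.Base using (inj₁; inj₂; [_,_]′)
open import Data.Vec.Base as Vec using (count)
open import Data.Vec.Functional using (_∷_)
open import Function.Base using (_∘_; id)
open import Function.Bundles using (Inverse; _⇔_; mk⇔; module Equivalence)
open import Function.Construct.Composition using () renaming (inverse to inverse-trans)
open import Function.Construct.Symmetry using () renaming (inverse to inverse-sym)
open import Level using (Level)
open import Relation.Binary.Bundles using (Setoid)
import Relation.Binary.Construct.On as On
open import Relation.Binary.Definitions using (tri<; tri≈; tri>; Tri)
open import Relation.Binary.PropositionalEquality
  using (_≡_; _≗_; refl; sym; trans; cong; cong₂; subst; setoid; module ≡-Reasoning)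
open import Relation.Nullary.Decidable
  using (Dec; yes; no; does; ¬?; _×-dec_; _→-dec_; does-⇔; dec-true)
open import Relation.Nullary.Negation using (contradiction; contradiction-irr)
open import Relation.Unary using (Pred; Decidable)

open import Algebra.Properties.Semiring.Sum ℕ.+-*-semiring
  using ( sum-cong-≗; sum-syntax; ∑-comm; ∑-distrib-+; *-distribˡ-sum; *-distribʳ-sum
        ; sum-replicate-zero)

private
  variable
    a b p q ℓ₁ ℓ₂ : Level
    A B : Set a
    P : Pred A p
    k m n : ℕ

-- Sums over Fin

∑-+ : ∀ m n (f : Fin (m + n) → ℕ) →
      ∑[ i < m + n ] f i ≡ ∑[ i < m ] f (i ↑ˡ n) + ∑[ j < n ] f (m ↑ʳ j)
∑-+ zero    n f = refl
∑-+ (suc m) n f = trans (cong (f zero +_) (∑-+ m n (f ∘ suc))) (sym (+-assoc (f zero) _ _))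

∑-* : ∀ m n (f : Fin (m * n) → ℕ) →
      ∑[ i < m * n ] f i ≡ ∑[ x < m ] ∑[ y < n ] f (combine x y)
∑-* zero    n f = refl
∑-* (suc m) n f = trans (∑-+ n (m * n) f) (cong (∑[ y < n ] f (y ↑ˡ (m * n)) +_) (∑-* m n (f ∘ (n ↑ʳ_))))

∑-const : ∀ n c → ∑[ i < n ] c ≡ n * c
∑-const zero    c = refl
∑-const (suc n) c = cong (c +_) (∑-const n c)

∑-applyUpTo : ∀ n (f : ℕ → ℕ) → List.sum (applyUpTo f n) ≡ ∑[ i < n ] f (toℕ i)
∑-applyUpTo zero    f = refl
∑-applyUpTo (suc n) f = cong (f 0 +_) (∑-applyUpTo n (f ∘ suc))

-- finToFun with its implicit arguments explicit: k ^ m determines neither k nor m.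
nthMap : ∀ m n → Fin (n ^ m) → Fin m → Fin n
nthMap m n = finToFun {n} {m}

nthMap-combine : ∀ {k m} (x : Fin k) (j : Fin (k ^ m)) →
                   nthMap (suc m) k (combine x j) ≗ x ∷ nthMap m k j
nthMap-combine x j zero    = cong proj₁ (Fin.remQuot-combine x j)
nthMap-combine {k} {m} x j (suc i) = cong (λ r → nthMap m k (proj₂ r) i) (Fin.remQuot-combine x j)

-- Recursion over all maps by their value at `zero`. The enumerated map agrees with
-- `x ∷ nthMap m k j` only pointwise, so `φ` has to respect `_≗_`.
∑-nthMap : ∀ k m (φ : (Fin (suc m) → Fin k) → ℕ) → (∀ {f g} → f ≗ g → φ f ≡ φ g) →
             ∑[ i < k ^ suc m ] φ (nthMap (suc m) k i) ≡ ∑[ x < k ] ∑[ j < k ^ m ] φ (x ∷ nthMap m k j)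
∑-nthMap k m φ φ-cong = trans
  (∑-* k (k ^ m) (φ ∘ nthMap (suc m) k))
  (sum-cong-≗ λ x → sum-cong-≗ λ j → φ-cong (nthMap-combine x j))

-- Counting with indicators

𝟙 : Dec A → ℕ
𝟙 a? = if does a? then 1 else 0

𝟙-cong : A ⇔ B → (a? : Dec A) (b? : Dec B) → 𝟙 a? ≡ 𝟙 b?
𝟙-cong A⇔B a? b? = cong (if_then 1 else 0) (does-⇔ A⇔B a? b?)

𝟙-× : (a? : Dec A) (b? : Dec B) → 𝟙 (a? ×-dec b?) ≡ 𝟙 a? * 𝟙 b?
𝟙-× (yes _) b? = sym (+-identityʳ _)
𝟙-× (no _)  b? = refl

𝟙-→ : (a? : Dec A) (b? : Dec B) → 𝟙 (a? →-dec b?) ≡ 𝟙 (¬? a?) + 𝟙 a? * 𝟙 b?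
𝟙-→ (yes _) b? = sym (+-identityʳ _)
𝟙-→ (no _)  b? = refl

𝟙-¬ : (a? : Dec A) → 𝟙 a? + 𝟙 (¬? a?) ≡ 1
𝟙-¬ (yes _) = refl
𝟙-¬ (no _)  = refl

𝟙-* : (a? : Dec A) {x y : ℕ} → (A → x ≡ y) → 𝟙 a? * x ≡ 𝟙 a? * y
𝟙-* (yes a) x≡y = cong (_+ 0) (x≡y a)
𝟙-* (no _)  x≡y = refl

#_ : {P : Pred (Fin n) p} → Decidable P → ℕ
#_ {n = n} P? = ∑[ i < n ] 𝟙 (P? i)

#-≤ : {P : Pred (Fin n) p} (P? : Decidable P) → # P? ≤ n
#-≤ {n = zero}  P? = z≤n
#-≤ {n = suc n} P? with P? zero
... | yes _ = s≤s (#-≤ (P? ∘ suc))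
... | no _  = m≤n⇒m≤1+n (#-≤ (P? ∘ suc))

#-¬ : {P : Pred (Fin n) p} (P? : Decidable P) → # (¬? ∘ P?) ≡ n ∸ # P?
#-¬ {n = n} P? = sym (begin
  n ∸ # P?                             ≡⟨ cong (_∸ # P?) (sym (trans (∑-const n 1) (*-identityʳ n))) ⟩
  ∑[ i < n ] 1 ∸ # P?                  ≡⟨ cong (_∸ # P?) (sum-cong-≗ (sym ∘ 𝟙-¬ ∘ P?)) ⟩
  ∑[ i < n ] (𝟙 (P? i) + 𝟙 (¬? (P? i))) ∸ # P?
    ≡⟨ cong (_∸ # P?) (∑-distrib-+ (𝟙 ∘ P?) (𝟙 ∘ ¬? ∘ P?)) ⟩
  (# P? + # (¬? ∘ P?)) ∸ # P?          ≡⟨ m+n∸m≡n (# P?) _ ⟩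
  # (¬? ∘ P?)                          ∎)
  where open ≡-Reasoning

#-all : {P : Pred (Fin n) p} (P? : Decidable P) → # P? ≡ n ⇔ (∀ i → P i)
#-all P? = mk⇔ (all P?) (none-missing P?)
  where
  all : ∀ {n} {P : Pred (Fin n) p} (P? : Decidable P) → # P? ≡ n → ∀ i → P i
  all {n = suc n} P? eq i with P? zero
  all {n = suc n} P? eq zero    | yes p₀ = p₀
  all {n = suc n} P? eq (suc i) | yes p₀ = all (P? ∘ suc) (suc-injective eq) i
  -- The remaining `n` points would have to account for a count of `suc n`.
  all {n = suc n} P? eq i       | no _   = contradiction (subst (_≤ n) eq (#-≤ (P? ∘ suc))) 1+n≰n

  none-missing : ∀ {n} {P : Pred (Fin n) p} (P? : Decidable P) → (∀ i → P i) → # P? ≡ n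
  none-missing {n = zero}  P? ∀P = refl
  none-missing {n = suc n} P? ∀P rewrite dec-true (P? zero) (∀P zero) =
    cong suc (none-missing (P? ∘ suc) (∀P ∘ suc))

∑-δ : (x : Fin n) (w : Fin n → ℕ) → ∑[ y < n ] (𝟙 (x ≟ y) * w y) ≡ w x
∑-δ {suc n} zero    w = trans (cong (w zero + 0 +_) (sum-replicate-zero n))
                              (trans (+-identityʳ _) (+-identityʳ _))
-- The term at `zero` computes to 0, and the truth value of `suc x ≟ suc y` computes to that of
-- `x ≟ y`.
∑-δ {suc n} (suc x) w = ∑-δ x (w ∘ suc)

#-nthMap : ∀ {k} m {P : Pred (Fin k) p} (P? : Decidable P) →
             # (λ (j : Fin (k ^ m)) → all? (P? ∘ nthMap m k j)) ≡ (# P?) ^ m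
#-nthMap {k = k} zero    P? = refl
#-nthMap {k = k} (suc m) {P} P? = begin
  # (λ (j : Fin (k ^ suc m)) → all? (P? ∘ nthMap (suc m) k j))
    ≡⟨ ∑-nthMap k m (λ f → 𝟙 (all? (P? ∘ f)))
         (λ {f} {g} f≗g → 𝟙-cong
           (mk⇔ (λ h i → subst P (f≗g i) (h i)) (λ h i → subst P (sym (f≗g i)) (h i)))
           (all? (P? ∘ f)) (all? (P? ∘ g))) ⟩
  ∑[ x < k ] ∑[ j < k ^ m ] 𝟙 (all? (P? ∘ (x ∷ nthMap m k j)))
    -- The condition splits into one on the first value and one on the tail; the indicator of a
    -- conjunction is a product, so the double sum factors.
    ≡⟨ sum-cong-≗ (λ x → sum-cong-≗ λ j → trans
         (𝟙-cong (mk⇔ (λ h → h zero , h ∘ suc) λ where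
                   (h₀ , h) zero    → h₀
                   (h₀ , h) (suc i) → h i)
                 (all? (P? ∘ (x ∷ nthMap m k j))) (P? x ×-dec all? (P? ∘ nthMap m k j)))
         (𝟙-× (P? x) (all? (P? ∘ nthMap m k j)))) ⟩
  ∑[ x < k ] ∑[ j < k ^ m ] (𝟙 (P? x) * 𝟙 (all? (P? ∘ nthMap m k j)))
    ≡⟨ sum-cong-≗ (λ x → sym (*-distribˡ-sum (𝟙 (P? x)) (λ (j : Fin (k ^ m)) → 𝟙 (all? (P? ∘ nthMap m k j))))) ⟩
  ∑[ x < k ] (𝟙 (P? x) * # (λ (j : Fin (k ^ m)) → all? (P? ∘ nthMap m k j)))
    ≡⟨ sum-cong-≗ (λ x → cong (𝟙 (P? x) *_) (#-nthMap m P?)) ⟩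
  ∑[ x < k ] (𝟙 (P? x) * (# P?) ^ m)
    ≡⟨ sym (*-distribʳ-sum ((# P?) ^ m) (𝟙 ∘ P?)) ⟩
  # P? * (# P?) ^ m ∎
  where open ≡-Reasoning

count-tabulate : {P : Pred A p} (P? : Decidable P) (f : Fin n → A) →
                 count P? (Vec.tabulate f) ≡ # (P? ∘ f)
count-tabulate {n = zero}  P? f = refl
count-tabulate {n = suc n} P? f with does (P? (f zero))
... | true  = cong suc (count-tabulate P? (f ∘ suc))
... | false = count-tabulate P? (f ∘ suc)

-- Maps with an image of given size

image? : (f : Fin m → Fin n) → Decidable (λ y → ∃ λ x → f x ≡ y)
image? f y = any? λ x → f x ≟ y

image-cong : {f g : Fin m → Fin n} → f ≗ g → # image? f ≡ # image? g
image-cong {f = f} {g} f≗g = sum-cong-≗ λ y → 𝟙-cong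
  (mk⇔ (λ (x , e) → x , trans (sym (f≗g x)) e) (λ (x , e) → x , trans (f≗g x) e)) (image? f y) (image? g y)

image-∷ : (x : Fin n) (f : Fin m → Fin n) →
          # image? (x ∷ f) ≡ 𝟙 (¬? (image? f x)) + # image? f
image-∷ {n = n} x f = begin
  # image? (x ∷ f)
    ≡⟨ sum-cong-≗ split ⟩
  ∑[ y < n ] (𝟙 (x ≟ y) * 𝟙 (¬? (image? f y)) + 𝟙 (image? f y))
    ≡⟨ ∑-distrib-+ (λ y → 𝟙 (x ≟ y) * 𝟙 (¬? (image? f y))) (𝟙 ∘ image? f) ⟩
  ∑[ y < n ] (𝟙 (x ≟ y) * 𝟙 (¬? (image? f y))) + # image? f
    ≡⟨ cong (_+ # image? f) (∑-δ x (𝟙 ∘ ¬? ∘ image? f)) ⟩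
  𝟙 (¬? (image? f x)) + # image? f ∎
  where
  open ≡-Reasoning
  split : ∀ y → 𝟙 (image? (x ∷ f) y) ≡ 𝟙 (x ≟ y) * 𝟙 (¬? (image? f y)) + 𝟙 (image? f y)
  -- The search over the domain of `x ∷ f` unfolds to the test at `zero` and the search over `f`,
  -- which are the two decisions abstracted here.
  split y with x ≟ y | any? (λ x → f x ≟ y)
  ... | yes _ | yes _ = refl
  ... | yes _ | no _  = refl
  ... | no _  | yes _ = refl
  ... | no _  | no _  = refl

-- Used with `P` the image of a map and `s` its size: a new first value inside the image keeps the
-- size, one outside raises it by one.
∑-shift : {P : Pred (Fin n) p} (P? : Decidable P) (φ : ℕ → ℕ) (s : ℕ) →
          ∑[ x < n ] φ (𝟙 (¬? (P? x)) + s) ≡ # P? * φ s + (n ∸ # P?) * φ (suc s)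
∑-shift {n = n} P? φ s = begin
  ∑[ x < n ] φ (𝟙 (¬? (P? x)) + s)
    ≡⟨ sum-cong-≗ (λ x → cases (P? x)) ⟩
  ∑[ x < n ] (𝟙 (P? x) * φ s + 𝟙 (¬? (P? x)) * φ (suc s))
    ≡⟨ ∑-distrib-+ (λ x → 𝟙 (P? x) * φ s) (λ x → 𝟙 (¬? (P? x)) * φ (suc s)) ⟩
  ∑[ x < n ] (𝟙 (P? x) * φ s) + ∑[ x < n ] (𝟙 (¬? (P? x)) * φ (suc s))
    ≡⟨ sym (cong₂ _+_ (*-distribʳ-sum (φ s) (𝟙 ∘ P?)) (*-distribʳ-sum (φ (suc s)) (𝟙 ∘ ¬? ∘ P?))) ⟩
  # P? * φ s + # (¬? ∘ P?) * φ (suc s)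
    ≡⟨ cong (λ c → # P? * φ s + c * φ (suc s)) (#-¬ P?) ⟩
  # P? * φ s + (n ∸ # P?) * φ (suc s) ∎
  where
  open ≡-Reasoning
  cases : (a? : Dec A) → φ (𝟙 (¬? a?) + s) ≡ 𝟙 a? * φ s + 𝟙 (¬? a?) * φ (suc s)
  cases (yes _) = sym (trans (+-identityʳ _) (+-identityʳ _))
  cases (no _)  = sym (+-identityʳ _)

-- This is `I m n d` of the overview; classically it equals n(n-1)...(n-d+1) times the Stirling
-- number of the second kind S(m,d).
#image≡ : ℕ → ℕ → ℕ → ℕ
#image≡ m n d = # (λ (i : Fin (n ^ m)) → # image? (nthMap m n i) ℕ.≟ d)

-- Fix the tail of the map and sum over its first value. The weight `φ` is arbitrary so that the
-- case of size 0 and the case of positive size are both instances.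
∑-image : ∀ m n (φ : ℕ → ℕ) →
          ∑[ i < n ^ suc m ] φ (# image? (nthMap (suc m) n i)) ≡
          ∑[ j < n ^ m ] (let s = # image? (nthMap m n j) in s * φ s + (n ∸ s) * φ (suc s))
∑-image m n φ = begin
  ∑[ i < n ^ suc m ] φ (# image? (nthMap (suc m) n i))
    ≡⟨ ∑-nthMap n m (φ ∘ λ f → # image? f) (cong φ ∘ image-cong) ⟩
  ∑[ x < n ] ∑[ j < n ^ m ] φ (# image? (x ∷ nthMap m n j))
    ≡⟨ ∑-comm (λ (x : Fin n) (j : Fin (n ^ m)) → φ (# image? (x ∷ nthMap m n j))) ⟩
  ∑[ j < n ^ m ] ∑[ x < n ] φ (# image? (x ∷ nthMap m n j))
    ≡⟨ sum-cong-≗ (λ j → trans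
         (sum-cong-≗ λ x → cong φ (image-∷ x (nthMap m n j)))
         (∑-shift (image? (nthMap m n j)) φ _)) ⟩
  ∑[ j < n ^ m ] (let s = # image? (nthMap m n j) in s * φ s + (n ∸ s) * φ (suc s)) ∎
  where open ≡-Reasoning

-- A nonempty domain has a nonempty image. In the recursion the indicator of `s + 1 = 0` is always
-- 0, and that of `s = 0` is multiplied by `s`.
#image≡0 : ∀ m n → #image≡ (suc m) n 0 ≡ 0
#image≡0 m n = trans (∑-image m n (λ s → 𝟙 (s ℕ.≟ 0)))
  (trans (sum-cong-≗ λ j → cases (# image? (nthMap m n j))) (sum-replicate-zero (n ^ m)))
  where
  cases : ∀ s → s * 𝟙 (s ℕ.≟ 0) + (n ∸ s) * 0 ≡ 0
  cases zero    = *-zeroʳ n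
  cases (suc s) = cong₂ _+_ (*-zeroʳ s) (*-zeroʳ (n ∸ suc s))

#image≡-suc : ∀ m n d →
              #image≡ (suc m) n (suc d) ≡ suc d * #image≡ m n (suc d) + (n ∸ d) * #image≡ m n d
#image≡-suc m n d = begin
  #image≡ (suc m) n (suc d)
    ≡⟨ ∑-image m n (λ s → 𝟙 (s ℕ.≟ suc d)) ⟩
  ∑[ j < n ^ m ] (s j * 𝟙 (s j ℕ.≟ suc d) + (n ∸ s j) * 𝟙 (suc (s j) ℕ.≟ suc d))
    ≡⟨ sum-cong-≗ (λ j → cong₂ _+_
         (move id (s j) (suc d)) (move (n ∸_) (s j) d)) ⟩
  ∑[ j < n ^ m ] (suc d * 𝟙 (s j ℕ.≟ suc d) + (n ∸ d) * 𝟙 (s j ℕ.≟ d))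
    ≡⟨ ∑-distrib-+ (λ j → suc d * 𝟙 (s j ℕ.≟ suc d)) (λ j → (n ∸ d) * 𝟙 (s j ℕ.≟ d)) ⟩
  ∑[ j < n ^ m ] (suc d * 𝟙 (s j ℕ.≟ suc d)) + ∑[ j < n ^ m ] ((n ∸ d) * 𝟙 (s j ℕ.≟ d))
    ≡⟨ sym (cong₂ _+_ (*-distribˡ-sum (suc d) (λ j → 𝟙 (s j ℕ.≟ suc d)))
                      (*-distribˡ-sum (n ∸ d) (λ j → 𝟙 (s j ℕ.≟ d)))) ⟩
  suc d * #image≡ m n (suc d) + (n ∸ d) * #image≡ m n d ∎
  where
  open ≡-Reasoning
  s : Fin (n ^ m) → ℕ
  s j = # image? (nthMap m n j)
  -- Under the indicator of `x = y` the weight may be evaluated at `y`, which turns it into a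
  -- constant that leaves the sum.
  move : ∀ (w : ℕ → ℕ) x y → w x * 𝟙 (x ℕ.≟ y) ≡ w y * 𝟙 (x ℕ.≟ y)
  move w x y = trans (*-comm (w x) _) (trans (𝟙-* (x ℕ.≟ y) (cong w)) (*-comm _ (w y)))

-- The absorption identity for binomial coefficients

[k+1]*nC[k+1]+k*nCk≡n*nCk : ∀ n k → suc k * (n C suc k) + k * (n C k) ≡ n * (n C k)
[k+1]*nC[k+1]+k*nCk≡n*nCk zero zero = refl
[k+1]*nC[k+1]+k*nCk≡n*nCk zero (suc k)
  rewrite k>n⇒nCk≡0 {0} {suc (suc k)} (s≤s z≤n) | k>n⇒nCk≡0 {0} {suc k} (s≤s z≤n) =
  cong₂ _+_ (*-zeroʳ k) (*-zeroʳ k)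
[k+1]*nC[k+1]+k*nCk≡n*nCk (suc n) zero =
  trans (+-identityʳ _) (trans (*-identityˡ _) (trans (nC1≡n (suc n)) (sym (*-identityʳ _))))
[k+1]*nC[k+1]+k*nCk≡n*nCk (suc n) (suc k)
  rewrite sym (nCk+nC[k+1]≡[n+1]C[k+1] n k) | sym (nCk+nC[k+1]≡[n+1]C[k+1] n (suc k)) = begin
  (2 + k) * (y + z) + (1 + k) * (x + y)
    -- After Pascal's rule, regrouping isolates the left sides of the induction hypotheses at
    -- `suc k` and at `k`, with `x + y` left over.
    ≡⟨ solve 4 (λ k x y z → (con 2 :+ k) :* (y :+ z) :+ (con 1 :+ k) :* (x :+ y) :=
         (((con 2 :+ k) :* z :+ (con 1 :+ k) :* y) :+ ((con 1 :+ k) :* y :+ k :* x)) :+ (x :+ y)) refl k x y z ⟩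
  ((2 + k) * z + (1 + k) * y) + ((1 + k) * y + k * x) + (x + y)
    ≡⟨ cong₂ (λ s t → s + t + (x + y)) ([k+1]*nC[k+1]+k*nCk≡n*nCk n (suc k)) ([k+1]*nC[k+1]+k*nCk≡n*nCk n k) ⟩
  n * y + n * x + (x + y)
    ≡⟨ solve 3 (λ n x y → n :* y :+ n :* x :+ (x :+ y) := (con 1 :+ n) :* (x :+ y)) refl n x y ⟩
  suc n * (x + y) ∎
  where
  open ≡-Reasoning
  open +-*-Solver
  x = n C k
  y = n C suc k
  z = n C suc (suc k)

-- The additive identity with `k * (n C k)` moved across; for `k ≥ n` both sides are 0.
[n∸k]*nCk≡[k+1]*nC[k+1] : ∀ n k → (n ∸ k) * (n C k) ≡ suc k * (n C suc k)
[n∸k]*nCk≡[k+1]*nC[k+1] n k = begin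
  (n ∸ k) * (n C k)                                   ≡⟨ *-distribʳ-∸ (n C k) n k ⟩
  n * (n C k) ∸ k * (n C k)                           ≡⟨ cong (_∸ k * (n C k)) (sym ([k+1]*nC[k+1]+k*nCk≡n*nCk n k)) ⟩
  suc k * (n C suc k) + k * (n C k) ∸ k * (n C k)     ≡⟨ m+n∸n≡m _ (k * (n C k)) ⟩
  suc k * (n C suc k)                                 ∎
  where open ≡-Reasoning

image-empty : ∀ n (f : Fin 0 → Fin n) → # image? f ≡ 0
image-empty n f = sum-replicate-zero n

-- Induction on `m`: by absorption, both sides obey the recursion of `#image≡-suc`.
#image≡-C : ∀ m n d → #image≡ m n d ≡ (n C d) * #image≡ m d d
#image≡-C zero n zero
  rewrite image-empty n (nthMap 0 n zero) = refl
#image≡-C zero n (suc d)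
  rewrite image-empty n (nthMap 0 n zero) | image-empty (suc d) (nthMap 0 (suc d) zero) = sym (*-zeroʳ (n C suc d))
#image≡-C (suc m) n zero
  rewrite #image≡0 m n | #image≡0 m 0 = refl
#image≡-C (suc m) n (suc d) = begin
  #image≡ (suc m) n (suc d)
    ≡⟨ #image≡-suc m n d ⟩
  suc d * #image≡ m n (suc d) + (n ∸ d) * #image≡ m n d
    ≡⟨ cong₂ (λ s t → suc d * s + (n ∸ d) * t) (#image≡-C m n (suc d)) (#image≡-C m n d) ⟩
  suc d * (c * s₁) + (n ∸ d) * ((n C d) * s₀)
    ≡⟨ cong (suc d * (c * s₁) +_) (trans (sym (*-assoc (n ∸ d) (n C d) s₀))
         (cong (_* s₀) ([n∸k]*nCk≡[k+1]*nC[k+1] n d))) ⟩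
  suc d * (c * s₁) + suc d * c * s₀
    ≡⟨ solve 4 (λ d c s₁ s₀ → d :* (c :* s₁) :+ d :* c :* s₀ := c :* (d :* s₁ :+ d :* s₀)) refl (suc d) c s₁ s₀ ⟩
  c * (suc d * s₁ + suc d * s₀)
    -- Absorption at `suc d`, with `suc d C suc d = 1`, writes the factor `suc d` as
    -- `(suc d ∸ d) * (suc d C d)`. The induction hypothesis for maps into `suc d` points, read
    -- backwards, then lets the recursion be folded up again.
    ≡⟨ cong (λ t → c * (suc d * s₁ + t)) (trans
         (cong (_* s₀) (sym (trans ([n∸k]*nCk≡[k+1]*nC[k+1] (suc d) d)
           (trans (cong (suc d *_) (nCn≡1 (suc d))) (*-identityʳ (suc d))))))
         (trans (*-assoc (suc d ∸ d) (suc d C d) s₀) (cong ((suc d ∸ d) *_) (sym (#image≡-C m (suc d) d))))) ⟩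
  c * (suc d * s₁ + (suc d ∸ d) * #image≡ m (suc d) d)
    ≡⟨ cong (c *_) (sym (#image≡-suc m (suc d) d)) ⟩
  c * #image≡ (suc m) (suc d) (suc d) ∎
  where
  open ≡-Reasoning
  open +-*-Solver
  c = n C suc d
  s₁ = #image≡ m (suc d) (suc d)
  s₀ = #image≡ m d d

-- Surjections, and sums over maps grouped by image size

#image≡-Surj : ∀ m k → #image≡ m k k ≡ Surj m k
#image≡-Surj m k = trans
  -- An image in `Fin k` has size `k` exactly when it contains every point.
  (sum-cong-≗ λ i → 𝟙-cong (#-all (image? (nthMap m k i)))
                          (# image? (nthMap m k i) ℕ.≟ k) (surjective? (nthMap m k i)))
  (sym (count-tabulate (λ i → surjective? (nthMap m k i)) id))

-- Double counting: each summand is spread over the sizes 0 to `n` that an image can have, and the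
-- two sums are exchanged.
∑-by-image : ∀ n .{{_ : NonZero n}} (h : ℕ → ℕ) →
             ∑[ i < n ^ n ] h (# image? (nthMap n n i)) ≡
             ∑[1≤ d ≤ n ] ((n C d) * h d * Surj n d)
∑-by-image n@(suc n-1) h = begin
  ∑[ i < n ^ n ] h (s i)
    ≡⟨ sum-cong-≗ (λ i → expand (s i) (#-≤ (image? (nthMap n n i)))) ⟩
  ∑[ i < n ^ n ] ∑[ d < suc n ] (𝟙 (s i ℕ.≟ toℕ d) * h (toℕ d))
    ≡⟨ ∑-comm (λ (i : Fin (n ^ n)) (d : Fin (suc n)) → 𝟙 (s i ℕ.≟ toℕ d) * h (toℕ d)) ⟩
  ∑[ d < suc n ] ∑[ i < n ^ n ] (𝟙 (s i ℕ.≟ toℕ d) * h (toℕ d))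
    ≡⟨ sum-cong-≗ (λ (d : Fin (suc n)) → sym (*-distribʳ-sum (h (toℕ d)) (λ i → 𝟙 (s i ℕ.≟ toℕ d)))) ⟩
  ∑[ d < suc n ] (#image≡ n n (toℕ d) * h (toℕ d))
    -- The term `d = 0` vanishes because the domain is nonempty, so the sum starts at 1.
    ≡⟨ cong (λ z → z * h 0 + ∑[ d < n ] (#image≡ n n (suc (toℕ d)) * h (suc (toℕ d)))) (#image≡0 n-1 n) ⟩
  ∑[ d < n ] (#image≡ n n (suc (toℕ d)) * h (suc (toℕ d)))
    ≡⟨ sum-cong-≗ {n} (λ d → closed (suc (toℕ d))) ⟩
  ∑[ d < n ] ((n C suc (toℕ d)) * h (suc (toℕ d)) * Surj n (suc (toℕ d)))
    ≡⟨ sym (∑-applyUpTo n (λ d → (n C suc d) * h (suc d) * Surj n (suc d))) ⟩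
  ∑[1≤ d ≤ n ] ((n C d) * h d * Surj n d) ∎
  where
  open ≡-Reasoning
  s : Fin (n ^ n) → ℕ
  s i = # image? (nthMap n n i)

  expand : ∀ s → s ≤ n → h s ≡ ∑[ d < suc n ] (𝟙 (s ℕ.≟ toℕ d) * h (toℕ d))
  expand s s≤n = sym (begin
    ∑[ d < suc n ] (𝟙 (s ℕ.≟ toℕ d) * h (toℕ d))
      ≡⟨ sum-cong-≗ (λ d → cong (_* h (toℕ d)) (𝟙-cong (mk⇔
           (λ e → Fin.toℕ-injective (trans (Fin.toℕ-fromℕ< _) e))
           (λ e → trans (sym (Fin.toℕ-fromℕ< _)) (cong toℕ e))) (s ℕ.≟ toℕ d) (fromℕ< (s≤s s≤n) ≟ d))) ⟩
    ∑[ d < suc n ] (𝟙 (fromℕ< (s≤s s≤n) ≟ d) * h (toℕ d))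
      ≡⟨ ∑-δ (fromℕ< (s≤s s≤n)) (h ∘ toℕ) ⟩
    h (toℕ (fromℕ< (s≤s s≤n)))
      ≡⟨ cong h (Fin.toℕ-fromℕ< _) ⟩
    h s ∎)

  closed : ∀ d → #image≡ n n d * h d ≡ (n C d) * h d * Surj n d
  closed d = trans (cong (_* h d) (trans (#image≡-C n n d) (cong ((n C d) *_) (#image≡-Surj n d))))
    (solve 3 (λ c s h → c :* s :* h := c :* h :* s) refl (n C d) (Surj n d) (h d))
    where open +-*-Solver

-- Splitting an operation into its diagonal and its off-diagonal pairs

-- The number of unordered pairs, computed by peeling off `zero`, which lies in `n` of them.
-- `offDiagonal` and `glue` follow the same recursion, so their indices match by `splitAt`.
triangular : ℕ → ℕ
triangular zero    = 0
triangular (suc n) = n + triangular n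

triangular≡nC2 : ∀ n → triangular n ≡ n C 2
triangular≡nC2 zero    = sym (k>n⇒nCk≡0 {0} {2} (s≤s z≤n))
triangular≡nC2 (suc n) = trans (cong₂ _+_ (sym (nC1≡n n)) (triangular≡nC2 n)) (nCk+nC[k+1]≡[n+1]C[k+1] n 1)

diagonal : (A → A → B) → A → B
diagonal _*_ x = x * x

offDiagonal : ∀ n → (Fin n → Fin n → A) → Fin (triangular n) → A × A
offDiagonal (suc n) _*_ i = [ (λ y → zero * suc y , suc y * zero) , offDiagonal n (λ x y → suc x * suc y) ]′
                              (splitAt n i)

glue : ∀ n → (Fin n → A) → (Fin (triangular n) → A × A) → Fin n → Fin n → A
glue (suc n) f g zero    zero    = f zero
glue (suc n) f g zero    (suc y) = proj₁ (g (y ↑ˡ triangular n))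
glue (suc n) f g (suc x) zero    = proj₂ (g (x ↑ˡ triangular n))
glue (suc n) f g (suc x) (suc y) = glue n (f ∘ suc) (g ∘ (n ↑ʳ_)) x y

glue-cong : ∀ n {f f′ : Fin n → A} {g g′} → f ≗ f′ → g ≗ g′ → ∀ x y → glue n f g x y ≡ glue n f′ g′ x y
glue-cong (suc n) f≗f′ g≗g′ zero    zero    = f≗f′ zero
glue-cong (suc n) f≗f′ g≗g′ zero    (suc y) = cong proj₁ (g≗g′ _)
glue-cong (suc n) f≗f′ g≗g′ (suc x) zero    = cong proj₂ (g≗g′ _)
glue-cong (suc n) f≗f′ g≗g′ (suc x) (suc y) = glue-cong n (f≗f′ ∘ suc) (g≗g′ ∘ (n ↑ʳ_)) x y

glue-diagonal : ∀ n (f : Fin n → A) g → diagonal (glue n f g) ≗ f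
glue-diagonal (suc n) f g zero    = refl
glue-diagonal (suc n) f g (suc x) = glue-diagonal n (f ∘ suc) (g ∘ (n ↑ʳ_)) x

glue-offDiagonal : ∀ n (f : Fin n → A) g → offDiagonal n (glue n f g) ≗ g
glue-offDiagonal (suc n) f g i with splitAt n i in eq
... | inj₁ y = cong g (Fin.splitAt⁻¹-↑ˡ eq)
... | inj₂ j = trans (glue-offDiagonal n (f ∘ suc) (g ∘ (n ↑ʳ_)) j) (cong g (Fin.splitAt⁻¹-↑ʳ {i = i} eq))

offDiagonal-cong : ∀ n {_*_ _*′_ : Fin n → Fin n → A} → (∀ x y → x * y ≡ x *′ y) →
                   offDiagonal n _*_ ≗ offDiagonal n _*′_
offDiagonal-cong (suc n) eq i with splitAt n i
... | inj₁ y = cong₂ _,_ (eq zero (suc y)) (eq (suc y) zero)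
... | inj₂ j = offDiagonal-cong n (λ x y → eq (suc x) (suc y)) j

glue-split : ∀ n (_*_ : Fin n → Fin n → A) x y → glue n (diagonal _*_) (offDiagonal n _*_) x y ≡ x * y
glue-split (suc n) _*_ zero    zero    = refl
glue-split (suc n) _*_ zero    (suc y) rewrite Fin.splitAt-↑ˡ n y (triangular n) = refl
glue-split (suc n) _*_ (suc x) zero    rewrite Fin.splitAt-↑ˡ n x (triangular n) = refl
glue-split (suc n) _*_ (suc x) (suc y) = trans
  (glue-cong n (λ _ → refl) shift x y)
  (glue-split n (λ x y → suc x * suc y) x y)
  where
  shift : ∀ i → offDiagonal (suc n) _*_ (n ↑ʳ i) ≡ offDiagonal n (λ x y → suc x * suc y) i
  shift i rewrite Fin.splitAt-↑ʳ n (triangular n) i = refl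

module _ {A : Set a} (Q : A × A → Set q) where

  -- The values of an unordered pair are stored in one order only; symmetry of `Q` supplies the
  -- other.
  glue-all : ∀ n {f : Fin n → A} {g} → (∀ {u v} → Q (u , v) → Q (v , u)) →
             (∀ x → Q (f x , f x)) → (∀ i → Q (g i)) → ∀ x y → Q (glue n f g x y , glue n f g y x)
  glue-all (suc n) Q-sym Qf Qg zero    zero    = Qf zero
  glue-all (suc n) Q-sym Qf Qg zero    (suc y) = Qg _
  glue-all (suc n) Q-sym Qf Qg (suc x) zero    = Q-sym (Qg _)
  glue-all (suc n) Q-sym Qf Qg (suc x) (suc y) = glue-all n Q-sym (Qf ∘ suc) (Qg ∘ (n ↑ʳ_)) x y

  offDiagonal-all : ∀ n {_*_ : Fin n → Fin n → A} → (∀ x y → Q (x * y , y * x)) → ∀ i → Q (offDiagonal n _*_ i)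
  offDiagonal-all (suc n) Q* i with splitAt n i
  ... | inj₁ y = Q* zero (suc y)
  ... | inj₂ j = offDiagonal-all n (λ x y → Q* (suc x) (suc y)) j

-- Regular operations

SymmetricValuesAreSquares : Op₂ A → Set _
SymmetricValuesAreSquares _*_ = ∀ x y → x * y ≡ y * x → ∃ λ z → z * z ≡ x * y

regular⇒symmetricValuesAreSquares : (_*_ : Op₂ A) → Regular (𝓜 A) _*_ → SymmetricValuesAreSquares _*_
regular⇒symmetricValuesAreSquares _*_ (_⊙_ , reg) x y xy≡yx =
  -- `reg x y` says `((x * y) ⊙ (y * x)) * ((y * x) ⊙ (x * y)) ≡ x * y`; identifying `y * x` with `x
  -- * y` makes the left side a square.
  (x * y) ⊙ (x * y) , subst (λ v → ((x * y) ⊙ v) * (v ⊙ (x * y)) ≡ x * y) (sym xy≡yx) (reg x y)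

-- A pseudo-inverse has to choose preimages of (u , v) and (v , u) that are swaps
-- of each other, so the search is only run for u < v.
symmetricValuesAreSquares⇒regular : (_*_ : Op₂ (Fin n)) → SymmetricValuesAreSquares _*_ → Regular (𝓜 (Fin n)) _*_
symmetricValuesAreSquares⇒regular {n} _*_ squares =
  _⊙_ , λ x y →
    ⊙-inverse (Fin.<-cmp (x * y) (y * x)) (Fin.<-cmp (y * x) (x * y)) (x , y , refl , refl) (squares x y)
  where
  Factor : Fin n → Fin n → Set
  Factor u v = ∃₂ λ x y → x * y ≡ u × y * x ≡ v

  factor? : ∀ u v → Dec (Factor u v)
  factor? u v = any? λ x → any? λ y → (x * y ≟ u) ×-dec (y * x ≟ v)

  root? : ∀ u → Dec (∃ λ z → z * z ≡ u)
  root? u = any? λ z → z * z ≟ u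

  -- The default `d` is reached only when `(u , v)` is no pair `(x * y , y * x)`, and there any
  -- value will do.
  choose : (d : Fin n) {P : Pred (Fin n) p} → Dec (∃ P) → Fin n
  choose d (yes (x , _)) = x
  choose d (no _)        = d

  choose₂ : (d : Fin n) {R : Fin n → Fin n → Set} → Dec (∃₂ R) → Fin n
  choose₂ d (yes (_ , y , _)) = y
  choose₂ d (no _)            = d

  pick : ∀ u v → Tri (u Fin.< v) (u ≡ v) (v Fin.< u) → Fin n
  pick u v (tri< _ _ _) = choose u (factor? u v)
  pick u v (tri≈ _ _ _) = choose u (root? u)
  -- The factorization found for `(v , u)` is reused: `v ⊙ u` is its first entry and `u ⊙ v` its
  -- second.
  pick u v (tri> _ _ _) = choose₂ u (factor? v u)

  _⊙_ : Op₂ (Fin n)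
  u ⊙ v = pick u v (Fin.<-cmp u v)

  ⊙-inverse : ∀ {u v} (t : Tri (u Fin.< v) (u ≡ v) (v Fin.< u)) (t′ : Tri (v Fin.< u) (v ≡ u) (u Fin.< v)) →
              Factor u v → (u ≡ v → ∃ λ z → z * z ≡ u) → pick u v t * pick v u t′ ≡ u
  ⊙-inverse {u} {v} (tri< _ _ _) (tri> _ _ _) fac _ with factor? u v
  ... | yes (_ , _ , xy≡u , _) = xy≡u
  ... | no ¬fac                = contradiction fac ¬fac
  ⊙-inverse {u} {v} (tri> _ _ _) (tri< _ _ _) (x , y , xy≡u , yx≡v) _ with factor? v u
  ... | yes (_ , _ , _ , yx≡u) = yx≡u
  ... | no ¬fac                = contradiction (y , x , yx≡v , xy≡u) ¬fac
  ⊙-inverse {u} (tri≈ _ refl _) (tri≈ _ _ _) _ root with root? u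
  ... | yes (_ , zz≡u) = zz≡u
  ... | no ¬root       = contradiction (root refl) ¬root
  -- From here on the two comparisons contradict each other.
  ⊙-inverse (tri< u<v _ _)  (tri< _ _ u≮v)   = contradiction u<v u≮v
  ⊙-inverse (tri< _ u≢v _)  (tri≈ _ v≡u _)   = contradiction (sym v≡u) u≢v
  ⊙-inverse (tri≈ _ u≡v _)  (tri< _ v≢u _)   = contradiction (sym u≡v) v≢u
  ⊙-inverse (tri≈ _ u≡v _)  (tri> _ v≢u _)   = contradiction (sym u≡v) v≢u
  ⊙-inverse (tri> _ u≢v _)  (tri≈ _ v≡u _)   = contradiction (sym v≡u) u≢v
  ⊙-inverse (tri> _ _ v<u)  (tri> v≮u _ _)   = contradiction v<u v≮u

Admissible : (Fin m → A) → A × A → Set _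
Admissible f (u , v) = u ≡ v → ∃ λ x → f x ≡ u

-- The diagonal pairs `(f x , f x)` are always admissible, so regularity constrains only `g`.
regular-glue : ∀ n {f : Fin n → Fin n} {g} → Regular (𝓜 (Fin n)) (glue n f g) ⇔ (∀ i → Admissible f (g i))
regular-glue n {f} {g} = mk⇔
  (λ reg i → subst (Admissible f) (glue-offDiagonal n f g i)
     (offDiagonal-all (Admissible f) n {glue n f g} (λ x y xy≡yx →
        let z , zz≡xy = regular⇒symmetricValuesAreSquares (glue n f g) reg x y xy≡yx
        in z , trans (sym (glue-diagonal n f g z)) zz≡xy) i))
  (λ adm → symmetricValuesAreSquares⇒regular (glue n f g) λ x y xy≡yx →
     let z , fz≡xy = glue-all (Admissible f) n
                       (λ h v≡u → let x , fx≡u = h (sym v≡u) in x , trans fx≡u (sym v≡u))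
                       (λ x _ → x , refl) adm x y xy≡yx
     in z , trans (glue-diagonal n f g z) fz≡xy)

-- Cardinalities of setoids

module _ {S : Setoid a ℓ₁} {T : Setoid b ℓ₂} where
  private
    module S = Setoid S
    module T = Setoid T

  mkInverse : (to : S.Carrier → T.Carrier) (from : T.Carrier → S.Carrier) →
              (∀ {x y} → x S.≈ y → to x T.≈ to y) → (∀ {x y} → x T.≈ y → from x S.≈ from y) →
              (∀ y → to (from y) T.≈ y) → (∀ x → from (to x) S.≈ x) → Inverse S T
  mkInverse to from to-cong from-cong to-from from-to = record
    { to        = to
    ; from      = from
    ; to-cong   = to-cong
    ; from-cong = from-cong
    ; inverse   = (λ y≈ → T.trans (to-cong y≈) (to-from _)) , (λ x≈ → S.trans (from-cong x≈) (from-to _))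
    }

  restrict : {P : Pred S.Carrier p} {Q : Pred T.Carrier q} (I : Inverse S T) →
             (∀ {x} → P x → Q (Inverse.to I x)) → (∀ {y} → Q y → P (Inverse.from I y)) →
             Inverse (On.setoid {B = ∃ P} S proj₁) (On.setoid {B = ∃ Q} T proj₁)
  restrict I P⇒Q Q⇒P = record
    { to        = λ (x , px) → to x , P⇒Q px
    ; from      = λ (y , qy) → from y , Q⇒P qy
    ; to-cong   = to-cong
    ; from-cong = from-cong
    ; inverse   = (λ y≈x → inverseˡ y≈x) , (λ x≈y → inverseʳ x≈y)
    }
    where open Inverse I

regular-resp-≈ : (M : Monoid a ℓ₁) → ∀ {x y} → Monoid._≈_ M x y → Regular M x → Regular M y
regular-resp-≈ M x≈y (z , xzx≈x) =
  z , M.trans (M.∙-cong (M.∙-congʳ (M.sym x≈y)) (M.sym x≈y)) (M.trans xzx≈x x≈y)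
  where module M = Monoid M

-- Enumerating a decidable subset of `Fin n`

rank : {P : Pred (Fin n) p} (P? : Decidable P) (i : Fin n) → .(P i) → Fin (# P?)
rank P? zero p with P? zero
... | yes _ = zero
... | no ¬p = contradiction-irr p ¬p
rank P? (suc i) p with P? zero
... | yes _ = suc (rank (P? ∘ suc) i p)
... | no _  = rank (P? ∘ suc) i p

unrank : {P : Pred (Fin n) p} (P? : Decidable P) → Fin (# P?) → ∃ P
unrank {n = suc n} P? r with P? zero
unrank {n = suc n} P? zero    | yes p = zero , p
unrank {n = suc n} P? (suc r) | yes _ = let i , p = unrank (P? ∘ suc) r in suc i , p
unrank {n = suc n} P? r       | no _  = let i , p = unrank (P? ∘ suc) r in suc i , p

-- The point `i` is a variable tied to the unranked one by an equation, so that it can be matched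
-- on; `pi` is irrelevant, so any witness serves.
rank-unrank : {P : Pred (Fin n) p} (P? : Decidable P) (r : Fin (# P?)) (i : Fin n) .(pi : P i) →
              proj₁ (unrank P? r) ≡ i → rank P? i pi ≡ r
rank-unrank P? r zero pi eq with P? zero
rank-unrank P? zero zero pi eq | yes _ = refl
rank-unrank P? r    zero pi eq | no ¬p = contradiction-irr pi ¬p
rank-unrank P? r (suc i) pi eq with P? zero
rank-unrank P? (suc r) (suc i) pi eq | yes _ = cong suc (rank-unrank (P? ∘ suc) r i pi (Fin.suc-injective eq))
rank-unrank P? r       (suc i) pi eq | no _  = rank-unrank (P? ∘ suc) r i pi (Fin.suc-injective eq)

unrank-rank : {P : Pred (Fin n) p} (P? : Decidable P) (i : Fin n) .(pi : P i) →
              proj₁ (unrank P? (rank P? i pi)) ≡ i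
unrank-rank P? zero pi with P? zero
... | yes _ = refl
... | no ¬p = contradiction-irr pi ¬p
unrank-rank P? (suc i) pi with P? zero
... | yes _ = cong suc (unrank-rank (P? ∘ suc) i pi)
... | no _  = cong suc (unrank-rank (P? ∘ suc) i pi)

#-cardinality : {P : Pred (Fin n) p} (P? : Decidable P) →
                HasCardinality (On.setoid {B = ∃ P} (setoid (Fin n)) proj₁) (# P?)
#-cardinality {P = P} P? = mkInverse (λ (i , pi) → rank P? i pi) (unrank P?)
  (λ {x} {y} → rank-cong {i = proj₁ x} {proj₁ y} (proj₂ x) (proj₂ y)) (cong (proj₁ ∘ unrank P?))
  (λ r → let i , pi = unrank P? r in rank-unrank P? r i pi refl) (λ (i , pi) → unrank-rank P? i pi)
  where
  rank-cong : ∀ {i j} (pi : P i) (pj : P j) → i ≡ j → rank P? i pi ≡ rank P? j pj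
  rank-cong _ _ refl = refl

-- Counting the regular operations

conjugate : {X : Set a} {Y : Set b} → Inverse (setoid X) (setoid Y) →
            Inverse (Monoid.setoid (𝓜 X)) (Monoid.setoid (𝓜 Y))
conjugate I = mkInverse
  (λ _*_ x y → to (from x * from y))
  (λ _*_ x y → from (to x * to y))
  (λ eq x y → cong to (eq _ _))
  (λ eq x y → cong from (eq _ _))
  (λ _*_ x y → trans (strictlyInverseˡ _) (cong₂ _*_ (strictlyInverseˡ x) (strictlyInverseˡ y)))
  (λ _*_ x y → trans (strictlyInverseʳ _) (cong₂ _*_ (strictlyInverseʳ x) (strictlyInverseʳ y)))
  where open Inverse I

conjugate-regular : {X : Set a} {Y : Set b} (I : Inverse (setoid X) (setoid Y)) {_*_ : Op₂ X} →
                    Regular (𝓜 X) _*_ → Regular (𝓜 Y) (Inverse.to (conjugate I) _*_)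
conjugate-regular I {_*_} (_⊙_ , reg) = Inverse.to (conjugate I) _⊙_ , λ x y →
  -- The inner round trips `from (to _)` cancel, which leaves the equation for the original
  -- operation.
  cong to (trans
    (cong₂ _*_
      (trans (strictlyInverseʳ _) (cong₂ _⊙_ (strictlyInverseʳ _) (strictlyInverseʳ _)))
      (trans (strictlyInverseʳ _) (cong₂ _⊙_ (strictlyInverseʳ _) (strictlyInverseʳ _))))
    (reg (from x) (from y)))
  where open Inverse I

funToFin-cong : {f g : Fin m → Fin n} → f ≗ g → funToFin f ≡ funToFin g
funToFin-cong {m = zero}  f≗g = refl
funToFin-cong {m = suc m} f≗g = cong₂ combine (f≗g zero) (funToFin-cong (f≗g ∘ suc))

-- One code for the diagonal map and one for the list of off-diagonal pairs. The cardinality stays a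
-- product so that the count can run over the two codes separately.
operations : ∀ n → HasCardinality (Monoid.setoid (𝓜 (Fin n))) (n ^ n * (n * n) ^ triangular n)
operations n = mkInverse encode decode
  (λ eq → cong₂ combine
     (funToFin-cong (λ x → eq x x))
     (funToFin-cong (cong (uncurry combine) ∘ offDiagonal-cong n eq)))
  (λ k≡l x y → cong (λ k → decode k x y) k≡l)
  encode-decode
  (λ _·_ x y → trans
     (glue-cong n (λ z → trans (cong (λ r → nthMap n n (proj₁ r) z) (Fin.remQuot-combine (code₁ _·_) (code₂ _·_)))
                               (Fin.finToFun-funToFin _ z))
                  (λ i → trans (cong (λ r → remQuot n (nthMap N (n * n) (proj₂ r) i))
                                     (Fin.remQuot-combine (code₁ _·_) (code₂ _·_)))
                         (trans (cong (remQuot n) (Fin.finToFun-funToFin _ i))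
                                (Fin.remQuot-combine _ _))) x y)
     (glue-split n _·_ x y))
  where
  N = triangular n

  code₁ : Op₂ (Fin n) → Fin (n ^ n)
  code₁ _·_ = funToFin (diagonal _·_)

  code₂ : Op₂ (Fin n) → Fin ((n * n) ^ N)
  code₂ _·_ = funToFin (uncurry combine ∘ offDiagonal n _·_)

  encode : Op₂ (Fin n) → Fin (n ^ n * (n * n) ^ N)
  encode _·_ = combine (code₁ _·_) (code₂ _·_)

  decode : Fin (n ^ n * (n * n) ^ N) → Op₂ (Fin n)
  decode k = let i , j = remQuot ((n * n) ^ N) k in glue n (nthMap n n i) (remQuot n ∘ nthMap N (n * n) j)

  encode-decode : ∀ k → encode (decode k) ≡ k
  encode-decode k = trans
    (cong₂ combine
      (trans (funToFin-cong (glue-diagonal n f g)) (Fin.funToFin-finToFin {n} {n} i))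
      (trans (funToFin-cong λ p → trans (cong (uncurry combine) (glue-offDiagonal n f g p))
                                        (Fin.combine-remQuot {n} n _))
             (Fin.funToFin-finToFin {N} {n * n} j)))
    (Fin.combine-remQuot {n ^ n} _ k)
    where
    i = proj₁ (remQuot {n ^ n} ((n * n) ^ N) k)
    j = proj₂ (remQuot {n ^ n} ((n * n) ^ N) k)
    f = nthMap n n i
    g = remQuot n ∘ nthMap N (n * n) j

-- Counting over a fixed diagonal

admissible? : (f : Fin m → Fin n) → Decidable (Admissible f)
admissible? f (u , v) = (u ≟ v) →-dec image? f u

#-admissible : (f : Fin m → Fin n) → # (admissible? f ∘ remQuot {n} n) ≡ n ^ 2 ∸ n + # image? f
#-admissible {n = n} f = begin
  # (admissible? f ∘ remQuot {n} n)
    ≡⟨ ∑-* n n (𝟙 ∘ admissible? f ∘ remQuot {n} n) ⟩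
  ∑[ u < n ] ∑[ v < n ] 𝟙 (admissible? f (remQuot n (combine u v)))
    ≡⟨ sum-cong-≗ (λ u → trans (sum-cong-≗ λ v → cong (𝟙 ∘ admissible? f) (Fin.remQuot-combine u v)) (row u)) ⟩
  ∑[ u < n ] (n ∸ 1 + 𝟙 (image? f u))
    ≡⟨ ∑-distrib-+ (λ (u : Fin n) → n ∸ 1) (𝟙 ∘ image? f) ⟩
  ∑[ u < n ] (n ∸ 1) + # image? f
    -- `n * (n ∸ 1)` becomes `n ^ 2 ∸ n`; the power unfolds to `n * (n * 1)`, hence the unit laws.
    ≡⟨ cong (_+ # image? f) (trans (∑-const n (n ∸ 1)) (trans (*-distribˡ-∸ n n 1)
         (cong₂ (λ s t → n * s ∸ t) (sym (*-identityʳ n)) (*-identityʳ n)))) ⟩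
  n ^ 2 ∸ n + # image? f ∎
  where
  open ≡-Reasoning
  -- The `n ∸ 1` values `v` other than `u` are all admissible; `v = u` is so exactly when `u` lies
  -- in the image of `f`.
  row : ∀ u → ∑[ v < n ] 𝟙 (admissible? f (u , v)) ≡ n ∸ 1 + 𝟙 (image? f u)
  row u = begin
    ∑[ v < n ] 𝟙 (admissible? f (u , v))
      ≡⟨ sum-cong-≗ (λ v → 𝟙-→ (u ≟ v) (image? f u)) ⟩
    ∑[ v < n ] (𝟙 (¬? (u ≟ v)) + 𝟙 (u ≟ v) * 𝟙 (image? f u))
      ≡⟨ ∑-distrib-+ (λ v → 𝟙 (¬? (u ≟ v))) (λ v → 𝟙 (u ≟ v) * 𝟙 (image? f u)) ⟩
    # (λ v → ¬? (u ≟ v)) + ∑[ v < n ] (𝟙 (u ≟ v) * 𝟙 (image? f u))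
      ≡⟨ cong₂ _+_ (trans (#-¬ (u ≟_)) (cong (n ∸_)
                     (trans (sum-cong-≗ λ v → sym (*-identityʳ (𝟙 (u ≟ v)))) (∑-δ u (λ _ → 1)))))
                   (∑-δ u (λ _ → 𝟙 (image? f u))) ⟩
    n ∸ 1 + 𝟙 (image? f u) ∎

theorem25 : ∀ {a} (X : Set a) (n : ℕ) .{{_ : NonZero n}} → HasCardinality (setoid X) n →
    let N = n C 2 in
    HasCardinality (regularElements (𝓜 X))
    (∑[1≤ d ≤ n ] ((n C d) * (n ^ 2 ∸ n + d) ^ N * Surj n d))
theorem25 X n X≅Fin = subst (HasCardinality (regularElements (𝓜 X))) total
  (inverse-trans (restrict (conjugate X≅Fin) (conjugate-regular X≅Fin) (conjugate-regular (inverse-sym X≅Fin)))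
  (inverse-trans (restrict (operations n)
              -- Regularity is first carried over to the decoded operation, which has the form
              -- `glue n f g` and agrees pointwise with `_*_`.
              (λ {_*_} reg → Equivalence.to (regular-glue n)
                 (regular-resp-≈ (𝓜 (Fin n)) (λ x y → sym (strictlyInverseʳ _*_ x y)) reg))
              (Equivalence.from (regular-glue n)))
           (#-cardinality (good? ∘ remQuot {n ^ n} ((n * n) ^ T)))))
  where
  open ≡-Reasoning
  open Inverse (operations n) using (strictlyInverseʳ)
  T = triangular n

  Good : Pred (Fin (n ^ n) × Fin ((n * n) ^ T)) _
  Good (i , j) = ∀ t → Admissible (nthMap n n i) (remQuot n (nthMap T (n * n) j t))

  good? : Decidable Good
  good? (i , j) = all? λ t → admissible? (nthMap n n i) (remQuot n (nthMap T (n * n) j t))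

  total : # (good? ∘ remQuot {n ^ n} ((n * n) ^ T)) ≡
          ∑[1≤ d ≤ n ] ((n C d) * (n ^ 2 ∸ n + d) ^ (n C 2) * Surj n d)
  total = begin
    # (good? ∘ remQuot {n ^ n} ((n * n) ^ T))
      ≡⟨ ∑-* (n ^ n) ((n * n) ^ T) (𝟙 ∘ good? ∘ remQuot {n ^ n} ((n * n) ^ T)) ⟩
    ∑[ i < n ^ n ] ∑[ j < (n * n) ^ T ] 𝟙 (good? (remQuot ((n * n) ^ T) (combine i j)))
      ≡⟨ sum-cong-≗ (λ (i : Fin (n ^ n)) → sum-cong-≗ λ (j : Fin ((n * n) ^ T)) →
           cong (𝟙 ∘ good?) (Fin.remQuot-combine i j)) ⟩
    ∑[ i < n ^ n ] ∑[ j < (n * n) ^ T ] 𝟙 (good? (i , j))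
      -- With the diagonal fixed, the off-diagonal pairs are chosen independently from the same
      -- admissible set, which gives a power.
      ≡⟨ sum-cong-≗ (λ i → trans
           (#-nthMap T (admissible? (nthMap n n i) ∘ remQuot {n} n))
           (cong₂ _^_ (#-admissible (nthMap n n i)) (triangular≡nC2 n))) ⟩
    ∑[ i < n ^ n ] ((n ^ 2 ∸ n + # image? (nthMap n n i)) ^ (n C 2))
      ≡⟨ ∑-by-image n (λ d → (n ^ 2 ∸ n + d) ^ (n C 2)) ⟩
    ∑[1≤ d ≤ n ] ((n C d) * (n ^ 2 ∸ n + d) ^ (n C 2) * Surj n d) ∎
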